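{- Let $\Gamma$ denote a $k$-regular graph on $n$ vertices and let $A$ denote its adjacency matrix. Then $\Gamma$ is closed distance magic if and only if there exists an eigenvector $v$ of $A$ with eigenvalue $-1$ such that a certain permutation of its entries results in the arithmetic sequence $$\frac{1-n}{2},\ \ldots,\ \frac{2i-1-n}{2},\ \ldots,\ \frac{n-1}{2}.$$ In particular, if $\Gamma$ is closed distance magic, then there exists an eigenvector of $A$ corresponding to the eigenvalue $-1$ for which all entries are pairwise distinct.
   Context: All graphs are finite, simple and undirected. For a vertex $u$, the closed neighborhood $N[u]$ consists of $u$ and all its neighbors. A closed distance magic labeling of a graph $\Gamma=(V,E)$ of order $n=|V|$ is a bijection $\ell:V\to\{1,2,\ldots,n\}$ for which there is a positive integer $r$ with $\sum_{x\in N[u]}\ell(x)=r$ for all $u\in V$. A graph is closed distance magic if it admits a closed distance magic labeling. Eigenvectors of $A$ are column vectors in $\mathbb{C}^n$ with entries indexed by $V$. In the arithmetic sequence, the $i$-th term is $\frac{2i-1-n}{2}$ for $1\le i\le n$.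
   Formalization: The formal statement assumes n ≥ 2; for n = 1 the claim fails, since the one-vertex graph is closed distance magic (r = 1) but its adjacency matrix (0) has no eigenvalue −1, and for n = 0 there is no nonzero vector. -}

module Defs where

open import Algebra.Bundles.Raw using (RawRing)
import Algebra.Definitions.RawMonoid as RawMonoidDefs
open import Data.Bool.Base using (if_then_else_)
open import Data.Fin.Base using (Fin; toℕ)
open import Data.Fin.Permutation using (Permutation′; _⟨$⟩ʳ_)
open import Data.Fin.Subset using (Subset; ⁅_⁆; _∪_; ∣_∣)
open import Data.Fin.Subset.Properties using (_∈?_)
import Data.Integer.Base as ℤ
open import Data.List.Base using (allFin; filter; map; sum)
open import Data.Nat.Base as ℕ using (ℕ; suc)
import Data.Nat.Properties as ℕₚ
open import Data.Product.Base using (∃-syntax; Σ-syntax; _×_; _,_)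
open import Data.Rational.Base as ℚ using (ℚ; 0ℚ; 1ℚ; ½)
import Data.Rational.Properties as ℚₚ
open import Data.Rational.Solver using (module +-*-Solver)
open import Data.Vec.Base using (tabulate)
open import Function.Bundles using (_⤖_; module Bijection)
open import Level using (0ℓ)
open import Relation.Binary.Core using (Rel)
open import Relation.Binary.Definitions using (Decidable; Irreflexive; Symmetric)
open import Relation.Binary.PropositionalEquality using (_≡_; _≢_; refl; sym; trans; cong; cong₂; subst)
open import Relation.Nullary.Decidable.Core using (does)
open import Relation.Nullary.Negation.Core using (¬_)

------------------------------------------------------------------------
-- Real numbers: Cauchy sequences of rationals, with equality "the
-- difference tends to 0".

IsCauchy : (ℕ → ℚ) → Set
IsCauchy x = ∀ ε → 0ℚ ℚ.< ε →
  ∃[ N ] (∀ m n → N ℕ.≤ m → N ℕ.≤ n → ℚ.∣ x m ℚ.- x n ∣ ℚ.< ε)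

record ℝ : Set where
  constructor mkℝ
  field
    seq    : ℕ → ℚ
    cauchy : IsCauchy seq

open ℝ public

infix 4 _≈ᴿ_

_≈ᴿ_ : Rel ℝ 0ℓ
x ≈ᴿ y = ∀ ε → 0ℚ ℚ.< ε →
  ∃[ N ] (∀ n → N ℕ.≤ n → ℚ.∣ seq x n ℚ.- seq y n ∣ ℚ.< ε)

abstract
  half-pos : ∀ {ε} → 0ℚ ℚ.< ε → 0ℚ ℚ.< ½ ℚ.* ε
  half-pos {ε} 0<ε =
    ℚₚ.positive⁻¹ (½ ℚ.* ε) {{ℚₚ.pos*pos⇒pos ½ ε {{ℚ.positive 0<ε}}}}

  half+half : ∀ ε → ½ ℚ.* ε ℚ.+ ½ ℚ.* ε ≡ ε
  half+half ε = trans (sym (ℚₚ.*-distribʳ-+ ε ½ ½)) (ℚₚ.*-identityˡ ε)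

  const-cauchy : ∀ q → IsCauchy (λ _ → q)
  const-cauchy q ε 0<ε = 0 , λ _ _ _ _ →
    subst (ℚ._< ε) (cong ℚ.∣_∣ (sym (ℚₚ.+-inverseʳ q))) 0<ε

  +-cauchy : ∀ {x y} → IsCauchy x → IsCauchy y → IsCauchy (λ n → x n ℚ.+ y n)
  +-cauchy {x} {y} cx cy ε 0<ε with cx (½ ℚ.* ε) (half-pos 0<ε) | cy (½ ℚ.* ε) (half-pos 0<ε)
  ... | N , hx | M , hy = N ℕ.⊔ M , λ m n p q → begin-strict
    ℚ.∣ (x m ℚ.+ y m) ℚ.- (x n ℚ.+ y n) ∣
      ≡⟨ cong ℚ.∣_∣ (rearrange (x m) (y m) (x n) (y n)) ⟩
    ℚ.∣ (x m ℚ.- x n) ℚ.+ (y m ℚ.- y n) ∣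
      ≤⟨ ℚₚ.∣p+q∣≤∣p∣+∣q∣ (x m ℚ.- x n) (y m ℚ.- y n) ⟩
    ℚ.∣ x m ℚ.- x n ∣ ℚ.+ ℚ.∣ y m ℚ.- y n ∣
      <⟨ ℚₚ.+-mono-< (hx m n (ℕₚ.m⊔n≤o⇒m≤o N M p) (ℕₚ.m⊔n≤o⇒m≤o N M q))
                     (hy m n (ℕₚ.m⊔n≤o⇒n≤o N M p) (ℕₚ.m⊔n≤o⇒n≤o N M q)) ⟩
    ½ ℚ.* ε ℚ.+ ½ ℚ.* ε
      ≡⟨ half+half ε ⟩
    ε ∎
    where
    open ℚₚ.≤-Reasoning
    rearrange : ∀ a b c d → (a ℚ.+ b) ℚ.- (c ℚ.+ d) ≡ (a ℚ.- c) ℚ.+ (b ℚ.- d)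
    rearrange = solve 4 (λ a b c d → (a :+ b) :- (c :+ d) := (a :- c) :+ (b :- d)) refl
      where open +-*-Solver

  neg-cauchy : ∀ {x} → IsCauchy x → IsCauchy (λ n → ℚ.- x n)
  neg-cauchy {x} cx ε 0<ε with cx ε 0<ε
  ... | N , hx = N , λ m n p q → subst (ℚ._< ε)
    (trans (sym (ℚₚ.∣-p∣≡∣p∣ (x m ℚ.- x n))) (cong ℚ.∣_∣ (ℚₚ.neg-distrib-+ (x m) (ℚ.- x n))))
    (hx m n p q)

  eventually-bounded : ∀ {x} → IsCauchy x →
    ∃[ N ] ∃[ B ] (0ℚ ℚ.< B × (∀ n → N ℕ.≤ n → ℚ.∣ x n ∣ ℚ.≤ B))
  eventually-bounded {x} cx with cx 1ℚ (ℚₚ.positive⁻¹ 1ℚ)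
  ... | N , hx = N , 1ℚ ℚ.+ ℚ.∣ x N ∣ ,
    ℚₚ.+-mono-<-≤ (ℚₚ.positive⁻¹ 1ℚ) (ℚₚ.0≤∣p∣ (x N)) , λ n p → begin
    ℚ.∣ x n ∣
      ≡⟨ cong ℚ.∣_∣ (split (x n) (x N)) ⟩
    ℚ.∣ (x n ℚ.- x N) ℚ.+ x N ∣
      ≤⟨ ℚₚ.∣p+q∣≤∣p∣+∣q∣ (x n ℚ.- x N) (x N) ⟩
    ℚ.∣ x n ℚ.- x N ∣ ℚ.+ ℚ.∣ x N ∣
      ≤⟨ ℚₚ.+-monoˡ-≤ ℚ.∣ x N ∣ (ℚₚ.<⇒≤ (hx n N p ℕₚ.≤-refl)) ⟩
    1ℚ ℚ.+ ℚ.∣ x N ∣ ∎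
    where
    open ℚₚ.≤-Reasoning
    split : ∀ a b → a ≡ (a ℚ.- b) ℚ.+ b
    split = solve 2 (λ a b → a := (a :- b) :+ b) refl
      where open +-*-Solver

  scale : ∀ B ε → 0ℚ ℚ.< B → 0ℚ ℚ.< ε → ∃[ δ ] (0ℚ ℚ.< δ × B ℚ.* δ ≡ ε)
  scale B ε 0<B 0<ε = B⁻¹ ℚ.* ε ,
    ℚₚ.positive⁻¹ (B⁻¹ ℚ.* ε)
      {{ℚₚ.pos*pos⇒pos B⁻¹ {{ℚₚ.1/pos⇒pos B {{ℚ.positive 0<B}}}} ε {{ℚ.positive 0<ε}}}} ,
    trans (sym (ℚₚ.*-assoc B B⁻¹ ε))
      (trans (cong (ℚ._* ε) (ℚₚ.*-inverseʳ B {{B≢0}})) (ℚₚ.*-identityˡ ε))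
    where
    B≢0 : ℚ.NonZero B
    B≢0 = ℚₚ.pos⇒nonZero B {{ℚ.positive 0<B}}
    B⁻¹ : ℚ
    B⁻¹ = ℚ.1/_ B {{B≢0}}

  ∣*∣-bound : ∀ {a b B δ} → 0ℚ ℚ.< B → ℚ.∣ a ∣ ℚ.≤ B → ℚ.∣ b ∣ ℚ.< δ →
    ℚ.∣ a ℚ.* b ∣ ℚ.< B ℚ.* δ
  ∣*∣-bound {a} {b} {B} {δ} 0<B a≤B b<δ = begin-strict
    ℚ.∣ a ℚ.* b ∣           ≡⟨ ℚₚ.∣p*q∣≡∣p∣*∣q∣ a b ⟩
    ℚ.∣ a ∣ ℚ.* ℚ.∣ b ∣     ≤⟨ ℚₚ.*-monoʳ-≤-nonNeg ℚ.∣ b ∣ {{ℚₚ.∣-∣-nonNeg b}} a≤B ⟩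
    B ℚ.* ℚ.∣ b ∣           <⟨ ℚₚ.*-monoʳ-<-pos B {{ℚ.positive 0<B}} b<δ ⟩
    B ℚ.* δ ∎
    where open ℚₚ.≤-Reasoning

  ∣ab-cd∣<ε : ∀ a b c d {B C δ η ε} → 0ℚ ℚ.< B → 0ℚ ℚ.< C →
    B ℚ.* δ ≡ ½ ℚ.* ε → C ℚ.* η ≡ ½ ℚ.* ε →
    ℚ.∣ a ∣ ℚ.≤ B → ℚ.∣ d ∣ ℚ.≤ C → ℚ.∣ b ℚ.- d ∣ ℚ.< δ → ℚ.∣ a ℚ.- c ∣ ℚ.< η →
    ℚ.∣ a ℚ.* b ℚ.- c ℚ.* d ∣ ℚ.< ε
  ∣ab-cd∣<ε a b c d {B} {C} {δ} {η} {ε} 0<B 0<C Bδ Cη a≤B d≤C b-d<δ a-c<η = begin-strict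
    ℚ.∣ a ℚ.* b ℚ.- c ℚ.* d ∣
      ≡⟨ cong ℚ.∣_∣ (rearrange a b c d) ⟩
    ℚ.∣ a ℚ.* (b ℚ.- d) ℚ.+ d ℚ.* (a ℚ.- c) ∣
      ≤⟨ ℚₚ.∣p+q∣≤∣p∣+∣q∣ (a ℚ.* (b ℚ.- d)) (d ℚ.* (a ℚ.- c)) ⟩
    ℚ.∣ a ℚ.* (b ℚ.- d) ∣ ℚ.+ ℚ.∣ d ℚ.* (a ℚ.- c) ∣
      <⟨ ℚₚ.+-mono-< (∣*∣-bound {a} {b ℚ.- d} 0<B a≤B b-d<δ) (∣*∣-bound {d} {a ℚ.- c} 0<C d≤C a-c<η) ⟩
    B ℚ.* δ ℚ.+ C ℚ.* η
      ≡⟨ cong₂ ℚ._+_ Bδ Cη ⟩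
    ½ ℚ.* ε ℚ.+ ½ ℚ.* ε
      ≡⟨ half+half ε ⟩
    ε ∎
    where
    open ℚₚ.≤-Reasoning
    rearrange : ∀ a b c d →
      a ℚ.* b ℚ.- c ℚ.* d ≡ a ℚ.* (b ℚ.- d) ℚ.+ d ℚ.* (a ℚ.- c)
    rearrange = solve 4 (λ a b c d → a :* b :- c :* d := a :* (b :- d) :+ d :* (a :- c)) refl
      where open +-*-Solver

  *-cauchy : ∀ {x y} → IsCauchy x → IsCauchy y → IsCauchy (λ n → x n ℚ.* y n)
  *-cauchy {x} {y} cx cy ε 0<ε =
    let N₁ , B , 0<B , x≤B = eventually-bounded {x} cx
        M₁ , C , 0<C , y≤C = eventually-bounded {y} cy
        δ , 0<δ , Bδ = scale B (½ ℚ.* ε) 0<B (half-pos 0<ε)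
        η , 0<η , Cη = scale C (½ ℚ.* ε) 0<C (half-pos 0<ε)
        N₂ , hx = cx η 0<η
        M₂ , hy = cy δ 0<δ
        N = N₁ ℕ.⊔ N₂
        M = M₁ ℕ.⊔ M₂
    in N ℕ.⊔ M , λ m n p q →
      ∣ab-cd∣<ε (x m) (y m) (x n) (y n) 0<B 0<C Bδ Cη
        (x≤B m (ℕₚ.m⊔n≤o⇒m≤o N₁ N₂ (ℕₚ.m⊔n≤o⇒m≤o N M p)))
        (y≤C n (ℕₚ.m⊔n≤o⇒m≤o M₁ M₂ (ℕₚ.m⊔n≤o⇒n≤o N M q)))
        (hy m n (ℕₚ.m⊔n≤o⇒n≤o M₁ M₂ (ℕₚ.m⊔n≤o⇒n≤o N M p)) (ℕₚ.m⊔n≤o⇒n≤o M₁ M₂ (ℕₚ.m⊔n≤o⇒n≤o N M q)))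
        (hx m n (ℕₚ.m⊔n≤o⇒n≤o N₁ N₂ (ℕₚ.m⊔n≤o⇒m≤o N M p)) (ℕₚ.m⊔n≤o⇒n≤o N₁ N₂ (ℕₚ.m⊔n≤o⇒m≤o N M q)))

infixl 6 _+ᴿ_
infixl 7 _*ᴿ_
infix  8 -ᴿ_

ℚ→ℝ : ℚ → ℝ
ℚ→ℝ q = mkℝ (λ _ → q) (const-cauchy q)

_+ᴿ_ : ℝ → ℝ → ℝ
x +ᴿ y = mkℝ (λ n → seq x n ℚ.+ seq y n) (+-cauchy {seq x} {seq y} (cauchy x) (cauchy y))

_*ᴿ_ : ℝ → ℝ → ℝ
x *ᴿ y = mkℝ (λ n → seq x n ℚ.* seq y n) (*-cauchy {seq x} {seq y} (cauchy x) (cauchy y))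

-ᴿ_ : ℝ → ℝ
-ᴿ x = mkℝ (λ n → ℚ.- seq x n) (neg-cauchy {seq x} (cauchy x))

------------------------------------------------------------------------
-- Complex numbers

infix 5 _+i_

record ℂ : Set where
  constructor _+i_
  field
    re : ℝ
    im : ℝ

ℚ→ℂ : ℚ → ℂ
ℚ→ℂ q = ℚ→ℝ q +i ℚ→ℝ 0ℚ

ℂ-rawRing : RawRing 0ℓ 0ℓ
ℂ-rawRing = record
  { Carrier = ℂ
  ; _≈_     = λ z w → (re z ≈ᴿ re w) × (im z ≈ᴿ im w)
  ; _+_     = λ z w → (re z +ᴿ re w) +i (im z +ᴿ im w)
  ; _*_     = λ z w → (re z *ᴿ re w +ᴿ -ᴿ (im z *ᴿ im w)) +i (re z *ᴿ im w +ᴿ im z *ᴿ re w)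
  ; -_      = λ z → (-ᴿ re z) +i (-ᴿ im z)
  ; 0#      = ℚ→ℂ 0ℚ
  ; 1#      = ℚ→ℂ 1ℚ
  }
  where open ℂ

open RawRing ℂ-rawRing public
  using (+-rawMonoid)
  renaming (_≈_ to _≈ᶜ_; _+_ to _+ᶜ_; _*_ to _*ᶜ_; -_ to -ᶜ_; 0# to 0ᶜ; 1# to 1ᶜ)

sumᶜ : ∀ {n} → (Fin n → ℂ) → ℂ
sumᶜ = RawMonoidDefs.sum +-rawMonoid

------------------------------------------------------------------------
-- Eigenvectors

Vectorᶜ : ℕ → Set
Vectorᶜ n = Fin n → ℂ

Matrixᶜ : ℕ → Set
Matrixᶜ n = Fin n → Fin n → ℂ

_*ᵥ_ : ∀ {n} → Matrixᶜ n → Vectorᶜ n → Vectorᶜ n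
(A *ᵥ v) u = sumᶜ (λ w → A u w *ᶜ v w)

IsEigenvector : ∀ {n} → Matrixᶜ n → ℂ → Vectorᶜ n → Set
IsEigenvector A μ v =
  ¬ (∀ u → v u ≈ᶜ 0ᶜ) × (∀ u → (A *ᵥ v) u ≈ᶜ μ *ᶜ v u)

PairwiseDistinct : ∀ {n} → Vectorᶜ n → Set
PairwiseDistinct v = ∀ u w → u ≢ w → ¬ (v u ≈ᶜ v w)

-- Fin is 0-based, so the index i of the sequence is suc (toℕ j).
arithmeticTerm : ∀ n → Fin n → ℚ
arithmeticTerm n j = (ℤ.+ (2 ℕ.* i) ℤ.- ℤ.+ 1 ℤ.- ℤ.+ n) ℚ./ 2
  where
  i : ℕ
  i = suc (toℕ j)

PermutesToArithmetic : ∀ {n} → Vectorᶜ n → Set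
PermutesToArithmetic {n} v =
  Σ[ π ∈ Permutation′ n ] (∀ j → v (π ⟨$⟩ʳ j) ≈ᶜ ℚ→ℂ (arithmeticTerm n j))

------------------------------------------------------------------------
-- Graphs on the vertex set Fin n

record Graph (n : ℕ) : Set₁ where
  field
    Adj    : Rel (Fin n) 0ℓ
    adj?   : Decidable Adj
    symm   : Symmetric Adj
    irrefl : Irreflexive _≡_ Adj

-- The bijection V → {1,…,n} is given as a bijection onto Fin n, whose
-- element i stands for the label suc (toℕ i).
label : ∀ {n} → Fin n ⤖ Fin n → Fin n → ℕ
label ℓ x = suc (toℕ (Bijection.to ℓ x))

sumOver : ∀ {n} → Subset n → (Fin n → ℕ) → ℕ
sumOver {n} S f = sum (map f (filter (_∈? S) (allFin n)))

module _ {n : ℕ} (Γ : Graph n) where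
  open Graph Γ

  N⟨_⟩ : Fin n → Subset n
  N⟨ u ⟩ = tabulate (λ x → does (adj? u x))

  N[_] : Fin n → Subset n
  N[ u ] = ⁅ u ⁆ ∪ N⟨ u ⟩

  Regular : ℕ → Set
  Regular k = ∀ u → ∣ N⟨ u ⟩ ∣ ≡ k

  adjacencyMatrix : Matrixᶜ n
  adjacencyMatrix u w = if does (adj? u w) then 1ᶜ else 0ᶜ

  IsClosedDistanceMagicLabeling : Fin n ⤖ Fin n → Set
  IsClosedDistanceMagicLabeling ℓ =
    ∃[ r ] (0 ℕ.< r × (∀ u → sumOver N[ u ] (label ℓ) ≡ r))

  ClosedDistanceMagic : Set
  ClosedDistanceMagic = ∃[ ℓ ] IsClosedDistanceMagicLabeling ℓ

{-# OPTIONS --safe #-}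
-- Write f for the labels and z = 2f − 1 − n for twice the entries of the
-- candidate eigenvector. For a k-regular graph, the z-values over N[u] sum to
-- twice the f-values minus (1 + n)(1 + k), so v = z/2 satisfies A v = −v exactly
-- when every closed-neighbourhood sum of f equals (1 + n)(1 + k)/2. Conversely,
-- if these sums all equal some r, double counting gives
-- n r = (1 + k) ∑ f = (1 + k) n (1 + n)/2, which forces r to be that value.
module Submission where

open import Defs
open import Data.Nat.Base using (ℕ; _≤_)
open import Data.Product.Base using (∃-syntax; _×_)
open import Function.Bundles using (_⇔_)

import Algebra.Properties.AbelianGroup as AbelianGroupProperties
import Algebra.Properties.Group as GroupProperties
import Algebra.Properties.Semiring.Sum as SemiringSum
open import Data.Bool.Base using (Bool; true; false; if_then_else_; _∨_)
open import Data.Fin.Base using (Fin; zero; suc; toℕ; fromℕ<)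
open import Data.Fin.Permutation using (_⟨$⟩ˡ_; inverseʳ; flip)
open import Data.Fin.Properties using (toℕ-injective) renaming (_≟_ to _≟ᶠ_)
open import Data.Fin.Subset using (_∈_; ∣_∣)
open import Data.Fin.Subset.Properties using (_∈?_; x∈⁅y⁆⇔x≡y; ∪⇔⊎)
open import Data.Integer.Base as ℤ using (ℤ; 0ℤ; +_; -[1+_])
import Data.Integer.Properties as ℤₚ
import Data.Integer.Solver as ℤ-Solver
open import Data.List.Base as List using (filter)
open import Data.Nat.Base as ℕ using (zero; suc; z≤n; s≤s)
import Data.Nat.ListAction as ListAction
import Data.Nat.Properties as ℕₚ
import Data.Nat.Solver as ℕ-Solver
open import Data.Product.Base using (_,_)
open import Data.Rational.Base as ℚ using (0ℚ; 1ℚ; ½; toℚᵘ)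
import Data.Rational.Properties as ℚₚ
import Data.Rational.Solver as ℚ-Solver
open import Data.Rational.Unnormalised.Base as ℚᵘ using (mkℚᵘ; *≡*)
import Data.Rational.Unnormalised.Properties as ℚᵘₚ
open import Data.Sum.Function.Propositional using (_⊎-⇔_)
import Data.Vec.Base as Vec
open import Data.Vec.Properties using (lookup∘tabulate; []=⇒lookup; lookup⇒[]=)
open import Function.Base using (_∘_; id)
open import Function.Bundles using (_⤖_; mk⇔; module Bijection; module Equivalence)
open import Function.Construct.Composition using (_⇔-∘_)
open import Function.Properties.Bijection using (⤖⇒↔)
open import Function.Properties.Inverse using (↔⇒⤖)
open import Level using (0ℓ)
open import Relation.Binary.PropositionalEquality
open import Relation.Nullary.Decidable using (does; yes; no; _⊎-dec_; does-⇔; dec-true; dec-false)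
open import Relation.Nullary.Negation using (¬_; contradiction)
open import Relation.Unary using (Pred; Decidable)

module Σℕ = SemiringSum ℕₚ.+-*-semiring
module Σℤ = SemiringSum ℤₚ.+-*-semiring
module ℤ-Group = AbelianGroupProperties ℤₚ.+-0-abelianGroup
module ℚ-Group = GroupProperties ℚₚ.+-0-group

-- Real and complex arithmetic

≗⇒≈ᴿ : ∀ x y → (∀ n → seq x n ≡ seq y n) → x ≈ᴿ y
≗⇒≈ᴿ x y eq ε 0<ε = 0 , λ n _ →
  subst (ℚ._< ε) (cong ℚ.∣_∣ (sym (trans (cong (ℚ._- seq y n) (eq n)) (ℚₚ.+-inverseʳ (seq y n))))) 0<ε

≈ᴿ-sym : ∀ x y → x ≈ᴿ y → y ≈ᴿ x
≈ᴿ-sym x y x≈y ε 0<ε with x≈y ε 0<ε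
... | N , h = N , λ n p → subst (ℚ._< ε) (∣-∣-swap (seq x n) (seq y n)) (h n p)
  where
  ∣-∣-swap : ∀ a b → ℚ.∣ a ℚ.- b ∣ ≡ ℚ.∣ b ℚ.- a ∣
  ∣-∣-swap a b = trans (sym (ℚₚ.∣-p∣≡∣p∣ (a ℚ.- b)))
    (cong ℚ.∣_∣ (solve 2 (λ a b → :- (a :- b) := b :- a) refl a b))
    where open ℚ-Solver.+-*-Solver

-ᴿ-cong : ∀ x y → x ≈ᴿ y → -ᴿ x ≈ᴿ -ᴿ y
-ᴿ-cong x y x≈y ε 0<ε with x≈y ε 0<ε
... | N , h = N , λ n p → subst (ℚ._< ε)
  (trans (sym (ℚₚ.∣-p∣≡∣p∣ (seq x n ℚ.- seq y n))) (cong ℚ.∣_∣ (ℚₚ.neg-distrib-+ (seq x n) (ℚ.- seq y n))))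
  (h n p)

∣p+q∣<ε : ∀ {ε} p q → ℚ.∣ p ∣ ℚ.< ½ ℚ.* ε → ℚ.∣ q ∣ ℚ.< ½ ℚ.* ε → ℚ.∣ p ℚ.+ q ∣ ℚ.< ε
∣p+q∣<ε {ε} p q p< q< = subst (ℚ.∣ p ℚ.+ q ∣ ℚ.<_) (half+half ε)
  (ℚₚ.≤-<-trans (ℚₚ.∣p+q∣≤∣p∣+∣q∣ p q) (ℚₚ.+-mono-< p< q<))

≈ᴿ-trans : ∀ x y z → x ≈ᴿ y → y ≈ᴿ z → x ≈ᴿ z
≈ᴿ-trans x y z x≈y y≈z ε 0<ε
  with x≈y (½ ℚ.* ε) (half-pos 0<ε) | y≈z (½ ℚ.* ε) (half-pos 0<ε)
... | N , hx | M , hy = N ℕ.⊔ M , λ n p → subst (λ q → ℚ.∣ q ∣ ℚ.< ε)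
  (telescope (seq x n) (seq y n) (seq z n))
  (∣p+q∣<ε (seq x n ℚ.- seq y n) (seq y n ℚ.- seq z n)
    (hx n (ℕₚ.m⊔n≤o⇒m≤o N M p)) (hy n (ℕₚ.m⊔n≤o⇒n≤o N M p)))
  where
  telescope : ∀ a b c → (a ℚ.- b) ℚ.+ (b ℚ.- c) ≡ a ℚ.- c
  telescope = solve 3 (λ a b c → (a :- b) :+ (b :- c) := a :- c) refl
    where open ℚ-Solver.+-*-Solver

+ᴿ-cong : ∀ x x′ y y′ → x ≈ᴿ x′ → y ≈ᴿ y′ → x +ᴿ y ≈ᴿ x′ +ᴿ y′
+ᴿ-cong x x′ y y′ x≈x′ y≈y′ ε 0<ε
  with x≈x′ (½ ℚ.* ε) (half-pos 0<ε) | y≈y′ (½ ℚ.* ε) (half-pos 0<ε)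
... | N , hx | M , hy = N ℕ.⊔ M , λ n p → subst (λ q → ℚ.∣ q ∣ ℚ.< ε)
  (rearrange (seq x n) (seq x′ n) (seq y n) (seq y′ n))
  (∣p+q∣<ε (seq x n ℚ.- seq x′ n) (seq y n ℚ.- seq y′ n)
    (hx n (ℕₚ.m⊔n≤o⇒m≤o N M p)) (hy n (ℕₚ.m⊔n≤o⇒n≤o N M p)))
  where
  rearrange : ∀ a b c d → (a ℚ.- b) ℚ.+ (c ℚ.- d) ≡ (a ℚ.+ c) ℚ.- (b ℚ.+ d)
  rearrange = solve 4 (λ a b c d → (a :- b) :+ (c :- d) := (a :+ c) :- (b :+ d)) refl
    where open ℚ-Solver.+-*-Solver

-- For constant sequences the difference is always `p - q`. If it were nonzero, its own absolute
-- value could serve as `ε`, giving `∣ p - q ∣ < ∣ p - q ∣`.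
ℚ→ℝ-injective : ∀ p q → ℚ→ℝ p ≈ᴿ ℚ→ℝ q → p ≡ q
ℚ→ℝ-injective p q p≈q with 0ℚ ℚₚ.<? ℚ.∣ p ℚ.- q ∣
... | no ≮ = begin
  p                ≡⟨ solve 2 (λ p q → p := (p :- q) :+ q) refl p q ⟩
  (p ℚ.- q) ℚ.+ q  ≡⟨ cong (ℚ._+ q) (ℚₚ.∣p∣≡0⇒p≡0 (p ℚ.- q)
                        (ℚₚ.≤-antisym (ℚₚ.≮⇒≥ ≮) (ℚₚ.0≤∣p∣ (p ℚ.- q)))) ⟩
  0ℚ ℚ.+ q         ≡⟨ ℚₚ.+-identityˡ q ⟩
  q                ∎
  where
  open ≡-Reasoning
  open ℚ-Solver.+-*-Solver
... | yes 0<∣p-q∣ with p≈q ℚ.∣ p ℚ.- q ∣ 0<∣p-q∣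
...   | N , h = contradiction (h N ℕₚ.≤-refl) (ℚₚ.<-irrefl refl)

-- _≈ᶜ_ unfolds to a statement about absolute values of differences, from which
-- Agda cannot infer the two numbers compared; the record keeps them visible.
infix 4 _≃ᶜ_

record _≃ᶜ_ (z w : ℂ) : Set where
  constructor wrap
  field
    unwrap : z ≈ᶜ w

open _≃ᶜ_

≗⇒≃ᶜ : ∀ {x x′ y y′} → (∀ n → seq x n ≡ seq x′ n) → (∀ n → seq y n ≡ seq y′ n) →
  (x +i y) ≃ᶜ (x′ +i y′)
≗⇒≃ᶜ {x} {x′} {y} {y′} r i = wrap (≗⇒≈ᴿ x x′ r , ≗⇒≈ᴿ y y′ i)

≃ᶜ-refl : ∀ {z} → z ≃ᶜ z
≃ᶜ-refl = ≗⇒≃ᶜ (λ _ → refl) (λ _ → refl)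

≃ᶜ-sym : ∀ {z w} → z ≃ᶜ w → w ≃ᶜ z
≃ᶜ-sym {x +i y} {x′ +i y′} (wrap (r , i)) = wrap (≈ᴿ-sym x x′ r , ≈ᴿ-sym y y′ i)

≃ᶜ-trans : ∀ {z₁ z₂ z₃} → z₁ ≃ᶜ z₂ → z₂ ≃ᶜ z₃ → z₁ ≃ᶜ z₃
≃ᶜ-trans {x₁ +i y₁} {x₂ +i y₂} {x₃ +i y₃} (wrap (r , i)) (wrap (r′ , i′)) =
  wrap (≈ᴿ-trans x₁ x₂ x₃ r r′ , ≈ᴿ-trans y₁ y₂ y₃ i i′)

-ᶜ-cong : ∀ {z w} → z ≃ᶜ w → -ᶜ z ≃ᶜ -ᶜ w
-ᶜ-cong {x +i y} {x′ +i y′} (wrap (r , i)) = wrap (-ᴿ-cong x x′ r , -ᴿ-cong y y′ i)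

+ᶜ-cong : ∀ {z z′ w w′} → z ≃ᶜ z′ → w ≃ᶜ w′ → z +ᶜ w ≃ᶜ z′ +ᶜ w′
+ᶜ-cong {x +i y} {x′ +i y′} {u +i v} {u′ +i v′} (wrap (r , i)) (wrap (r′ , i′)) =
  wrap (+ᴿ-cong x x′ u u′ r r′ , +ᴿ-cong y y′ v v′ i i′)

module _ where
  open ℚ-Solver.+-*-Solver

  *ᶜ-identityˡ : ∀ z → 1ᶜ *ᶜ z ≃ᶜ z
  *ᶜ-identityˡ (x +i y) = ≗⇒≃ᶜ
    (λ n → solve 2 (λ a b → con 1ℚ :* a :+ (:- (con 0ℚ :* b)) := a) refl (seq x n) (seq y n))
    (λ n → solve 2 (λ a b → con 1ℚ :* b :+ con 0ℚ :* a := b) refl (seq x n) (seq y n))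

  *ᶜ-zeroˡ : ∀ z → 0ᶜ *ᶜ z ≃ᶜ 0ᶜ
  *ᶜ-zeroˡ (x +i y) = ≗⇒≃ᶜ
    (λ n → solve 2 (λ a b → con 0ℚ :* a :+ (:- (con 0ℚ :* b)) := con 0ℚ) refl (seq x n) (seq y n))
    (λ n → solve 2 (λ a b → con 0ℚ :* b :+ con 0ℚ :* a := con 0ℚ) refl (seq x n) (seq y n))

  -1*z≃-z : ∀ z → (-ᶜ 1ᶜ) *ᶜ z ≃ᶜ -ᶜ z
  -1*z≃-z (x +i y) = ≗⇒≃ᶜ
    (λ n → solve 2 (λ a b → (:- con 1ℚ) :* a :+ (:- ((:- con 0ℚ) :* b)) := :- a) refl (seq x n) (seq y n))
    (λ n → solve 2 (λ a b → (:- con 1ℚ) :* b :+ (:- con 0ℚ) :* a := :- b) refl (seq x n) (seq y n))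

-- Half-integers as complex numbers

-- Reduction to lowest terms blocks computation for variable numerators, so the identity is checked
-- on unnormalised fractions, where the sum has denominator 4.
/2-homo-+ : ∀ a b → (a ℤ.+ b) ℚ./ 2 ≡ a ℚ./ 2 ℚ.+ b ℚ./ 2
/2-homo-+ a b = ℚₚ.toℚᵘ-injective (begin
  toℚᵘ ((a ℤ.+ b) ℚ./ 2)                ≈⟨ ℚₚ.toℚᵘ-fromℚᵘ (mkℚᵘ (a ℤ.+ b) 1) ⟩
  mkℚᵘ (a ℤ.+ b) 1                      ≈⟨ *≡* (solve 2 (λ a b → (a :+ b) :* con (+ 4) := (a :* con (+ 2) :+ b :* con (+ 2)) :* con (+ 2)) refl a b) ⟩
  mkℚᵘ a 1 ℚᵘ.+ mkℚᵘ b 1                ≈⟨ ℚᵘₚ.+-cong (ℚₚ.toℚᵘ-fromℚᵘ (mkℚᵘ a 1)) (ℚₚ.toℚᵘ-fromℚᵘ (mkℚᵘ b 1)) ⟨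
  toℚᵘ (a ℚ./ 2) ℚᵘ.+ toℚᵘ (b ℚ./ 2)    ≈⟨ ℚₚ.toℚᵘ-homo-+ (a ℚ./ 2) (b ℚ./ 2) ⟨
  toℚᵘ (a ℚ./ 2 ℚ.+ b ℚ./ 2)            ∎)
  where
  open ℚᵘₚ.≃-Reasoning
  open ℤ-Solver.+-*-Solver

/2-homo-neg : ∀ a → (ℤ.- a) ℚ./ 2 ≡ ℚ.- (a ℚ./ 2)
-- `_/_` splits on the sign of the numerator and already negates in the negative case; only there
-- does a double negation remain.
/2-homo-neg (+ zero)  = refl
/2-homo-neg (+ suc m) = refl
/2-homo-neg -[1+ m ]  = sym (ℚ-Group.⁻¹-involutive (+ suc m ℚ./ 2))

/2-injective : ∀ {a b} → a ℚ./ 2 ≡ b ℚ./ 2 → a ≡ b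
/2-injective {a} {b} eq with ℚₚ./-injective-≃ (mkℚᵘ a 1) (mkℚᵘ b 1) eq
... | *≡* a*2≡b*2 = ℤₚ.*-cancelʳ-≡ a b (+ 2) a*2≡b*2

half : ℤ → ℂ
half a = ℚ→ℂ (a ℚ./ 2)

half-homo-+ : ∀ a b → half a +ᶜ half b ≃ᶜ half (a ℤ.+ b)
half-homo-+ a b = ≗⇒≃ᶜ (λ _ → sym (/2-homo-+ a b)) (λ _ → refl)

half-homo-neg : ∀ a → -ᶜ half a ≃ᶜ half (ℤ.- a)
half-homo-neg a = ≗⇒≃ᶜ (λ _ → sym (/2-homo-neg a)) (λ _ → refl)

half-injective : ∀ {a b} → half a ≃ᶜ half b → a ≡ b
half-injective {a} {b} (wrap (r , _)) = /2-injective (ℚ→ℝ-injective (a ℚ./ 2) (b ℚ./ 2) r)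

-- Together with `half-injective`, this moves the eigenvalue equation from Cauchy sequences to `ℤ`.
sumᶜ-half : ∀ {n} {z : Fin n → ℂ} {a : Fin n → ℤ} →
  (∀ i → z i ≃ᶜ half (a i)) → sumᶜ z ≃ᶜ half (Σℤ.sum a)
sumᶜ-half {zero}          h = ≃ᶜ-refl
sumᶜ-half {suc n} {a = a} h = ≃ᶜ-trans
  (+ᶜ-cong (h zero) (sumᶜ-half (h ∘ suc)))
  (half-homo-+ (a zero) (Σℤ.sum (a ∘ suc)))

-- Finite sums

sum-const : ∀ n c → Σℕ.sum {n} (λ _ → c) ≡ n ℕ.* c
sum-const zero    c = refl
sum-const (suc n) c = cong (c ℕ.+_) (sum-const n c)

2*sum-suc-toℕ : ∀ n → 2 ℕ.* Σℕ.sum {n} (λ j → suc (toℕ j)) ≡ n ℕ.* suc n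
2*sum-suc-toℕ zero    = refl
2*sum-suc-toℕ (suc n) = begin
  -- Splitting off index 0 shifts the remaining terms by one each, which adds `n` to the shorter
  -- sum.
  2 ℕ.* (1 ℕ.+ Σℕ.sum {n} (λ j → 1 ℕ.+ suc (toℕ j)))
    ≡⟨ cong (λ s → 2 ℕ.* (1 ℕ.+ s)) (Σℕ.∑-distrib-+ {n} (λ _ → 1) (λ j → suc (toℕ j))) ⟩
  2 ℕ.* (1 ℕ.+ (Σℕ.sum {n} (λ _ → 1) ℕ.+ t))
    ≡⟨ cong (λ s → 2 ℕ.* (1 ℕ.+ (s ℕ.+ t))) (sum-const n 1) ⟩
  2 ℕ.* (1 ℕ.+ (n ℕ.* 1 ℕ.+ t))
    ≡⟨ solve 2 (λ n t → con 2 :* (con 1 :+ (n :* con 1 :+ t)) := con 2 :+ con 2 :* n :+ con 2 :* t) refl n t ⟩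
  2 ℕ.+ 2 ℕ.* n ℕ.+ 2 ℕ.* t
    ≡⟨ cong (2 ℕ.+ 2 ℕ.* n ℕ.+_) (2*sum-suc-toℕ n) ⟩
  2 ℕ.+ 2 ℕ.* n ℕ.+ n ℕ.* suc n
    ≡⟨ solve 1 (λ n → con 2 :+ con 2 :* n :+ n :* (con 1 :+ n) := (con 1 :+ n) :* (con 2 :+ n)) refl n ⟩
  suc n ℕ.* suc (suc n) ∎
  where
  open ≡-Reasoning
  open ℕ-Solver.+-*-Solver
  t = Σℕ.sum {n} (λ j → suc (toℕ j))

infix 8 _when_

-- An Iverson bracket: sums over subsets become sums over all of `Fin n`, which can be interchanged
-- and split.
_when_ : ℕ → Bool → ℕ
m when b = if b then m else 0

when-* : ∀ m b → m when b ≡ m ℕ.* (1 when b)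
when-* m true  = sym (ℕₚ.*-identityʳ m)
when-* m false = sym (ℕₚ.*-zeroʳ m)

-- `allFin` is `tabulate id`; the general `g` is what lets the induction pass to the tail
-- `tabulate (g ∘ suc)`.
sum-filter : ∀ {n m} {P : Pred (Fin n) 0ℓ} (P? : Decidable P) (f : Fin n → ℕ) (g : Fin m → Fin n) →
  ListAction.sum (List.map f (filter P? (List.tabulate g))) ≡ Σℕ.sum (λ i → f (g i) when does (P? (g i)))
sum-filter {m = zero}  P? f g = refl
sum-filter {m = suc m} P? f g with does (P? (g zero))
... | true  = cong (f (g zero) ℕ.+_) (sum-filter P? f (g ∘ suc))
... | false = sum-filter P? f (g ∘ suc)

∣tabulate∣ : ∀ {n} (b : Fin n → Bool) → ∣ Vec.tabulate b ∣ ≡ Σℕ.sum (λ i → 1 when b i)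
∣tabulate∣ {zero}  b = refl
∣tabulate∣ {suc n} b with b zero
... | true  = cong suc (∣tabulate∣ (b ∘ suc))
... | false = ∣tabulate∣ (b ∘ suc)

sum-single : ∀ {n} (u : Fin n) (f : Fin n → ℕ) → Σℕ.sum (λ x → f x when does (x ≟ᶠ u)) ≡ f u
sum-single {suc n} zero f = trans
  (cong (f zero ℕ.+_) (trans (sum-const n 0) (ℕₚ.*-zeroʳ n)))
  (ℕₚ.+-identityʳ (f zero))
sum-single {suc n} (suc u) f = sum-single u (f ∘ suc)

-- Written exactly like the numerator in `arithmeticTerm`, so that `half (centred n (suc (toℕ j)))`
-- is the `j`-th term by definition.
centred : ℕ → ℕ → ℤ
centred n m = + (2 ℕ.* m) ℤ.- + 1 ℤ.- + n

centred-injective : ∀ n {a b} → centred n a ≡ centred n b → a ≡ b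
centred-injective n {a} {b} eq = ℕₚ.*-cancelˡ-≡ a b 2 (ℤₚ.+-injective
  (ℤ-Group.∙-cancelʳ (ℤ.- + 1) _ _ (ℤ-Group.∙-cancelʳ (ℤ.- + n) _ _ eq)))

-- Each selected index contributes `2 f - (1 + n)`. The constants are collected by the number of
-- selected indices, which becomes the degree when `b` is adjacency.
sum-centred : ∀ {m} n (b : Fin m → Bool) (f : Fin m → ℕ) →
  Σℤ.sum (λ i → if b i then centred n (f i) else 0ℤ) ≡
  + 2 ℤ.* + Σℕ.sum (λ i → f i when b i) ℤ.- + suc n ℤ.* + Σℕ.sum (λ i → 1 when b i)
sum-centred {zero}  n b f = sym (cong (λ t → 0ℤ ℤ.- t) (ℤₚ.*-zeroʳ (+ suc n)))
sum-centred {suc m} n b f with b zero | sum-centred n (b ∘ suc) (f ∘ suc)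
... | false | ih = trans (ℤₚ.+-identityˡ _) ih
... | true  | ih = trans (cong₂ (λ p q → (p ℤ.- + 1 ℤ.- + n) ℤ.+ q) (ℤₚ.pos-* 2 (f zero)) ih)
  (solve 4 (λ n x s d →
      con (+ 2) :* x :- con (+ 1) :- n :+ (con (+ 2) :* s :- (con (+ 1) :+ n) :* d) :=
      con (+ 2) :* (x :+ s) :- (con (+ 1) :+ n) :* (con (+ 1) :+ d))
    refl (+ n) (+ f zero) (+ s) (+ d))
  where
  open ℤ-Solver.+-*-Solver
  s = Σℕ.sum (λ i → f (suc i) when b (suc i))
  d = Σℕ.sum (λ i → 1 when b (suc i))

-- Neighbourhood sums

∈-tabulate-does : ∀ {n} {P : Pred (Fin n) 0ℓ} (P? : Decidable P) {x} →
  x ∈ Vec.tabulate (does ∘ P?) ⇔ P x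
∈-tabulate-does P? {x} = mk⇔ to from
  where
  to : x ∈ Vec.tabulate (does ∘ P?) → _
  to x∈ with P? x | trans (sym (lookup∘tabulate (does ∘ P?) x)) ([]=⇒lookup x∈)
  -- The `no` case is excluded by the second equation, which would read `false ≡ true`.
  ... | yes p | _ = p
  from : _ → x ∈ Vec.tabulate (does ∘ P?)
  from p = lookup⇒[]= x _ (trans (lookup∘tabulate (does ∘ P?) x) (dec-true (P? x) p))

module _ {n : ℕ} (Γ : Graph n) where
  open Graph Γ

  openSum : (Fin n → ℕ) → Fin n → ℕ
  openSum f u = Σℕ.sum (λ w → f w when does (adj? u w))

  degree : Fin n → ℕ
  degree = openSum (λ _ → 1)

  regular⇒degree : ∀ {k} → Regular Γ k → ∀ u → degree u ≡ k
  regular⇒degree reg u = trans (sym (∣tabulate∣ (λ x → does (adj? u x)))) (reg u)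

  does-∈N[] : ∀ u x → does (x ∈? N[_] Γ u) ≡ does (x ≟ᶠ u) ∨ does (adj? u x)
  does-∈N[] u x = does-⇔
    ((x∈⁅y⁆⇔x≡y ⊎-⇔ ∈-tabulate-does (adj? u)) ⇔-∘ ∪⇔⊎)
    (x ∈? N[_] Γ u) ((x ≟ᶠ u) ⊎-dec adj? u x)

  sumOver-N[] : ∀ f u → sumOver (N[_] Γ u) f ≡ f u ℕ.+ openSum f u
  sumOver-N[] f u = begin
    sumOver (N[_] Γ u) f
      ≡⟨ sum-filter (_∈? N[_] Γ u) f id ⟩
    Σℕ.sum (λ x → f x when does (x ∈? N[_] Γ u))
      ≡⟨ Σℕ.sum-cong-≗ split ⟩
    Σℕ.sum (λ x → f x when does (x ≟ᶠ u) ℕ.+ f x when does (adj? u x))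
      ≡⟨ Σℕ.∑-distrib-+ (λ x → f x when does (x ≟ᶠ u)) (λ x → f x when does (adj? u x)) ⟩
    Σℕ.sum (λ x → f x when does (x ≟ᶠ u)) ℕ.+ openSum f u
      ≡⟨ cong (ℕ._+ openSum f u) (sum-single u f) ⟩
    f u ℕ.+ openSum f u ∎
    where
    open ≡-Reasoning
    split : ∀ x → f x when does (x ∈? N[_] Γ u) ≡ f x when does (x ≟ᶠ u) ℕ.+ f x when does (adj? u x)
    split x rewrite does-∈N[] u x with x ≟ᶠ u
    ... | no _ = refl
    -- Irreflexivity keeps `u` from being counted twice, once as itself and once as its own
    -- neighbour.
    ... | yes refl rewrite dec-false (adj? x x) (irrefl refl) = sym (ℕₚ.+-identityʳ (f x))

  -- Double counting: after interchanging the sums, symmetry of adjacency shows that `f w` is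
  -- counted once for each neighbour of `w`.
  sum-openSum : ∀ f → Σℕ.sum (openSum f) ≡ Σℕ.sum (λ w → f w ℕ.* degree w)
  sum-openSum f = trans
    (Σℕ.∑-comm (λ u w → f w when does (adj? u w)))
    (Σℕ.sum-cong-≗ λ w → trans
      (Σℕ.sum-cong-≗ λ u → trans
        (cong (f w when_) (does-⇔ (mk⇔ symm symm) (adj? u w) (adj? w u)))
        (when-* (f w) (does (adj? w u))))
      (sym (Σℕ.*-distribˡ-sum (f w) (λ u → 1 when does (adj? w u)))))

  -- The magic equations are summed over all vertices and the common factor `n` is cancelled.
  -- Doubling avoids division in `ℕ`.
  magicConstant : ∀ {k r} f → .{{ℕ.NonZero n}} → (∀ u → degree u ≡ k) →
    2 ℕ.* Σℕ.sum f ≡ n ℕ.* suc n → (∀ u → f u ℕ.+ openSum f u ≡ r) →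
    2 ℕ.* r ≡ suc n ℕ.* suc k
  magicConstant {k} {r} f deg 2∑f magic = ℕₚ.*-cancelˡ-≡ (2 ℕ.* r) (suc n ℕ.* suc k) n (begin
    n ℕ.* (2 ℕ.* r)
      ≡⟨ solve 2 (λ n r → n :* (con 2 :* r) := con 2 :* (n :* r)) refl n r ⟩
    2 ℕ.* (n ℕ.* r)
      ≡⟨ cong (2 ℕ.*_) (sym (sum-const n r)) ⟩
    2 ℕ.* Σℕ.sum {n} (λ _ → r)
      ≡⟨ cong (2 ℕ.*_) (Σℕ.sum-cong-≗ (sym ∘ magic)) ⟩
    2 ℕ.* Σℕ.sum (λ u → f u ℕ.+ openSum f u)
      ≡⟨ cong (2 ℕ.*_) (Σℕ.∑-distrib-+ f (openSum f)) ⟩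
    2 ℕ.* (Σℕ.sum f ℕ.+ Σℕ.sum (openSum f))
      ≡⟨ cong (λ s → 2 ℕ.* (Σℕ.sum f ℕ.+ s)) (sum-openSum f) ⟩
    2 ℕ.* (Σℕ.sum f ℕ.+ Σℕ.sum (λ w → f w ℕ.* degree w))
      ≡⟨ cong (λ s → 2 ℕ.* (Σℕ.sum f ℕ.+ s)) (Σℕ.sum-cong-≗ (λ w → cong (f w ℕ.*_) (deg w))) ⟩
    2 ℕ.* (Σℕ.sum f ℕ.+ Σℕ.sum (λ w → f w ℕ.* k))
      ≡⟨ cong (λ s → 2 ℕ.* (Σℕ.sum f ℕ.+ s)) (sym (Σℕ.*-distribʳ-sum k f)) ⟩
    2 ℕ.* (Σℕ.sum f ℕ.+ Σℕ.sum f ℕ.* k)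
      ≡⟨ solve 2 (λ s k → con 2 :* (s :+ s :* k) := (con 2 :* s) :* (con 1 :+ k)) refl (Σℕ.sum f) k ⟩
    2 ℕ.* Σℕ.sum f ℕ.* suc k
      ≡⟨ cong (ℕ._* suc k) 2∑f ⟩
    n ℕ.* suc n ℕ.* suc k
      ≡⟨ ℕₚ.*-assoc n (suc n) (suc k) ⟩
    n ℕ.* (suc n ℕ.* suc k) ∎)
    where
    open ≡-Reasoning
    open ℕ-Solver.+-*-Solver

  -- Twice the u-th entry of A v, when v is half the vector of centred labels.
  2[Av] : (Fin n → ℕ) → Fin n → ℤ
  2[Av] f u = Σℤ.sum (λ w → if does (adj? u w) then centred n (f w) else 0ℤ)

  -- The left side is twice the `u`-th entry of `A v + v`, so the eigenvalue equation at `u` says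
  -- that the right side vanishes. The neighbours supply `k` copies of `1 + n` and `u` itself one
  -- more.
  2[Av]+centred : ∀ {k} f → (∀ u → degree u ≡ k) → ∀ u →
    2[Av] f u ℤ.+ centred n (f u) ≡ + (2 ℕ.* (f u ℕ.+ openSum f u)) ℤ.- + (suc n ℕ.* suc k)
  2[Av]+centred {k} f deg u = begin
    2[Av] f u ℤ.+ centred n (f u)
      ≡⟨ cong₂ (λ p q → p ℤ.+ (q ℤ.- + 1 ℤ.- + n))
           (sum-centred n (λ w → does (adj? u w)) f) (ℤₚ.pos-* 2 (f u)) ⟩
    (+ 2 ℤ.* + s ℤ.- + suc n ℤ.* + degree u) ℤ.+ (+ 2 ℤ.* + f u ℤ.- + 1 ℤ.- + n)
      ≡⟨ cong (λ d → (+ 2 ℤ.* + s ℤ.- + suc n ℤ.* + d) ℤ.+ (+ 2 ℤ.* + f u ℤ.- + 1 ℤ.- + n)) (deg u) ⟩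
    (+ 2 ℤ.* + s ℤ.- + suc n ℤ.* + k) ℤ.+ (+ 2 ℤ.* + f u ℤ.- + 1 ℤ.- + n)
      ≡⟨ solve 4 (λ n x s k →
           (con (+ 2) :* s :- (con (+ 1) :+ n) :* k) :+ (con (+ 2) :* x :- con (+ 1) :- n) :=
           con (+ 2) :* (x :+ s) :- (con (+ 1) :+ n) :* (con (+ 1) :+ k))
         refl (+ n) (+ f u) (+ s) (+ k) ⟩
    + 2 ℤ.* + (f u ℕ.+ s) ℤ.- + suc n ℤ.* + suc k
      ≡⟨ cong₂ ℤ._-_ (sym (ℤₚ.pos-* 2 (f u ℕ.+ s))) (sym (ℤₚ.pos-* (suc n) (suc k))) ⟩
    + (2 ℕ.* (f u ℕ.+ s)) ℤ.- + (suc n ℕ.* suc k) ∎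
    where
    open ≡-Reasoning
    open ℤ-Solver.+-*-Solver
    s = openSum f u

  -- The eigenvalue equation in integers

  adjacency-*ᵥ : ∀ {v} f → (∀ w → v w ≃ᶜ half (centred n (f w))) →
    ∀ u → (adjacencyMatrix Γ *ᵥ v) u ≃ᶜ half (2[Av] f u)
  adjacency-*ᵥ {v} f h u = sumᶜ-half entry
    where
    entry : ∀ w → adjacencyMatrix Γ u w *ᶜ v w ≃ᶜ half (if does (adj? u w) then centred n (f w) else 0ℤ)
    entry w with does (adj? u w)
    ... | true  = ≃ᶜ-trans (*ᶜ-identityˡ (v w)) (h w)
    ... | false = *ᶜ-zeroˡ (v w)

  neg-entry : ∀ {z} a → z ≃ᶜ half a → (-ᶜ 1ᶜ) *ᶜ z ≃ᶜ half (ℤ.- a)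
  neg-entry {z} a h = ≃ᶜ-trans (-1*z≃-z z) (≃ᶜ-trans (-ᶜ-cong h) (half-homo-neg a))

  -- The bridge for both directions of the theorem, valid at each vertex separately. Extracting the
  -- integer equation relies on injectivity of `half`.
  eigen-equation : ∀ {k v} f → (∀ u → degree u ≡ k) → (∀ w → v w ≃ᶜ half (centred n (f w))) →
    ∀ u → ((adjacencyMatrix Γ *ᵥ v) u ≃ᶜ (-ᶜ 1ᶜ) *ᶜ v u) ⇔ (2 ℕ.* (f u ℕ.+ openSum f u) ≡ suc n ℕ.* suc k)
  eigen-equation {k} {v} f deg h u = mk⇔ to from
    where
    z = centred n (f u)
    to : (adjacencyMatrix Γ *ᵥ v) u ≃ᶜ (-ᶜ 1ᶜ) *ᶜ v u → 2 ℕ.* (f u ℕ.+ openSum f u) ≡ suc n ℕ.* suc k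
    to eq = ℤₚ.+-injective (ℤₚ.i-j≡0⇒i≡j _ _ (begin
      + (2 ℕ.* (f u ℕ.+ openSum f u)) ℤ.- + (suc n ℕ.* suc k)  ≡⟨ 2[Av]+centred f deg u ⟨
      2[Av] f u ℤ.+ z  ≡⟨ cong (ℤ._+ z) (half-injective {2[Av] f u} {ℤ.- z}
        (≃ᶜ-trans (≃ᶜ-sym (adjacency-*ᵥ f h u)) (≃ᶜ-trans eq (neg-entry z (h u))))) ⟩
      ℤ.- z ℤ.+ z      ≡⟨ ℤₚ.+-inverseˡ z ⟩
      0ℤ               ∎))
      where open ≡-Reasoning
    from : 2 ℕ.* (f u ℕ.+ openSum f u) ≡ suc n ℕ.* suc k → (adjacencyMatrix Γ *ᵥ v) u ≃ᶜ (-ᶜ 1ᶜ) *ᶜ v u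
    from eq = ≃ᶜ-trans (adjacency-*ᵥ f h u)
      (subst (λ a → half a ≃ᶜ (-ᶜ 1ᶜ) *ᶜ v u) (sym 2[Av]≡-z) (≃ᶜ-sym (neg-entry z (h u))))
      where
      2[Av]≡-z : 2[Av] f u ≡ ℤ.- z
      2[Av]≡-z = ℤ-Group.∙-cancelʳ z _ _ (trans (2[Av]+centred f deg u)
        (trans (ℤₚ.i≡j⇒i-j≡0 (cong +_ eq)) (sym (ℤₚ.+-inverseˡ z))))

-- Labelings and eigenvectors

distinct⇒nonzero : ∀ {n} → 2 ≤ n → (v : Vectorᶜ n) → PairwiseDistinct v → ¬ (∀ u → v u ≈ᶜ 0ᶜ)
-- Two different vertices are needed here: for `n = 1` the arithmetic sequence is the single term 0.
distinct⇒nonzero (s≤s (s≤s _)) v distinct v≈0 =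
  distinct zero (suc zero) (λ ()) (unwrap
    (≃ᶜ-trans {v zero} {0ᶜ} {v (suc zero)} (wrap (v≈0 zero)) (≃ᶜ-sym (wrap (v≈0 (suc zero))))))

module _ (n k : ℕ) (2≤n : 2 ≤ n) (Γ : Graph n) (reg : Regular Γ k) where

  instance
    n-nonZero : ℕ.NonZero n
    n-nonZero = ℕ.>-nonZero (ℕₚ.<-trans (s≤s z≤n) 2≤n)

  deg : ∀ u → degree Γ u ≡ k
  deg = regular⇒degree Γ reg

  magicVector : Fin n ⤖ Fin n → Vectorᶜ n
  magicVector ℓ u = half (centred n (label ℓ u))

  magicVector-distinct : ∀ ℓ → PairwiseDistinct (magicVector ℓ)
  magicVector-distinct ℓ u w u≢w eq = u≢w (Bijection.injective ℓ (toℕ-injective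
    (ℕₚ.suc-injective (centred-injective n (half-injective (wrap eq))))))

  magicVector-eigenvector : ∀ ℓ → IsClosedDistanceMagicLabeling Γ ℓ →
    IsEigenvector (adjacencyMatrix Γ) (-ᶜ 1ᶜ) (magicVector ℓ)
  magicVector-eigenvector ℓ (r , _ , magic) =
    distinct⇒nonzero 2≤n (magicVector ℓ) (magicVector-distinct ℓ) ,
    λ u → unwrap (Equivalence.from (eigen-equation Γ (label ℓ) deg (λ _ → ≃ᶜ-refl) u)
      -- Both sides equal `2 * r`.
      (trans (cong (2 ℕ.*_) (closed u)) (magicConstant Γ (label ℓ) deg 2∑label closed)))
    where
    closed : ∀ u → label ℓ u ℕ.+ openSum Γ (label ℓ) u ≡ r
    closed u = trans (sym (sumOver-N[] Γ (label ℓ) u)) (magic u)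
    2∑label : 2 ℕ.* Σℕ.sum (label ℓ) ≡ n ℕ.* suc n
    -- The labels are a rearrangement of 1 to `n`.
    2∑label = trans (cong (2 ℕ.*_) (sym (Σℕ.sum-permute (λ j → suc (toℕ j)) (⤖⇒↔ ℓ)))) (2*sum-suc-toℕ n)

  magicVector-permutes : ∀ ℓ → PermutesToArithmetic (magicVector ℓ)
  -- Position `j` must receive the vertex labelled `suc (toℕ j)`, so the permutation is the inverse
  -- of `ℓ`.
  magicVector-permutes ℓ = flip (⤖⇒↔ ℓ) , λ j →
    subst (λ i → half (centred n (suc (toℕ i))) ≈ᶜ half (centred n (suc (toℕ j))))
      (sym (inverseʳ (⤖⇒↔ ℓ))) (unwrap (≃ᶜ-refl {half (centred n (suc (toℕ j)))}))

  eigenvector⇒magic : ∀ v → IsEigenvector (adjacencyMatrix Γ) (-ᶜ 1ᶜ) v → PermutesToArithmetic v →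
    ClosedDistanceMagic Γ
  -- The magic constant is read off at one vertex `u₀`; it is positive because it includes the label
  -- of `u₀`.
  eigenvector⇒magic v (_ , eigen) (π , v∘π) = ℓ , sumOver (N[_] Γ u₀) f ,
    subst (0 ℕ.<_) (sym (sumOver-N[] Γ f u₀)) (s≤s z≤n) ,
    λ u → ℕₚ.*-cancelˡ-≡ _ _ 2 (trans (closed u) (sym (closed u₀)))
    where
    -- `π` sends positions to vertices, so its inverse gives each vertex its position as a label.
    ℓ = ↔⇒⤖ (flip π)
    f = label ℓ
    u₀ : Fin n
    -- `2 ≤ n` unfolds to `1 < n`, so this is the vertex with index 1.
    u₀ = fromℕ< 2≤n
    entries : ∀ w → v w ≃ᶜ half (centred n (f w))
    entries w = subst (λ x → v x ≃ᶜ half (centred n (f w))) (inverseʳ π) (wrap (v∘π (π ⟨$⟩ˡ w)))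
    closed : ∀ u → 2 ℕ.* sumOver (N[_] Γ u) f ≡ suc n ℕ.* suc k
    closed u = trans (cong (2 ℕ.*_) (sumOver-N[] Γ f u))
      (Equivalence.to (eigen-equation Γ f deg entries u) (wrap (eigen u)))

theorem2p2 : (n k : ℕ) → 2 ≤ n → (Γ : Graph n) → Regular Γ k →
    (ClosedDistanceMagic Γ ⇔ (∃[ v ] (IsEigenvector (adjacencyMatrix Γ) (-ᶜ 1ᶜ) v × PermutesToArithmetic v)))
    × (ClosedDistanceMagic Γ → ∃[ v ] (IsEigenvector (adjacencyMatrix Γ) (-ᶜ 1ᶜ) v × PairwiseDistinct v))
theorem2p2 n k 2≤n Γ reg =
  mk⇔
    (λ (ℓ , magic) → magicVector n k 2≤n Γ reg ℓ ,
      magicVector-eigenvector n k 2≤n Γ reg ℓ magic , magicVector-permutes n k 2≤n Γ reg ℓ)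
    (λ (v , eigen , perm) → eigenvector⇒magic n k 2≤n Γ reg v eigen perm) ,
  -- The same vector serves again: its entries are distinct because the labels are.
  λ (ℓ , magic) → magicVector n k 2≤n Γ reg ℓ ,
    magicVector-eigenvector n k 2≤n Γ reg ℓ magic , magicVector-distinct n k 2≤n Γ reg ℓ
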